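{- There are $\mathcal{O}(n^2 \log^2 n)$ 2D-runs in an $n \times n$ array $A$.
   Context: For an $m\times n$ array $A$, $A[i_1\,..\,i_2,j_1\,..\,j_2]$ is the subarray formed by rows $i_1,\dots,i_2$ and columns $j_1,\dots,j_2$. A positive integer $p$ is a horizontal period of an array $B$ if the $i$-th column of $B$ equals the $(i+p)$-th column for all valid $i$; $\mathsf{hper}(B)$ is the smallest horizontal period. Similarly, $q$ is a vertical period if the $i$-th row equals the $(i+q)$-th row for all valid $i$; $\mathsf{vper}(B)$ is the smallest vertical period. An $r\times c$ subarray $B=A[i_1\,..\,i_2,j_1\,..\,j_2]$ is a 2D-run if $\mathsf{hper}(B)\le c/2$, $\mathsf{vper}(B)\le r/2$, and extending $B$ by a row or column (i.e., by any of $A[i_1-1,j_1\,..\,j_2]$, $A[i_2+1,j_1\,..\,j_2]$, $A[i_1\,..\,i_2,j_1-1]$, $A[i_1\,..\,i_2,j_2+1]$ that exists) would change its smallest vertical or smallest horizontal period. 2D-runs are counted as positioned subarrays (different positions count as different 2D-runs). -}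

module Defs where

open import Data.Nat using (ℕ; suc; _+_; _*_; _∸_; _≤_; _<_)
open import Data.Product using (_×_; ∃-syntax)
open import Relation.Nullary using (¬_)
open import Relation.Binary.PropositionalEquality using (_≡_)

-- An n×n array over alphabet S is modelled as A : ℕ → ℕ → S where only
-- entries A i j with i < n, j < n are ever inspected below.

-- A positioned subarray A[i1..i2, j1..j2] (rows i1..i2, columns j1..j2).
record Rect : Set where
  constructor rect
  field
    i1 i2 j1 j2 : ℕ
open Rect public

ValidIn : ℕ → Rect → Set
ValidIn n R = i1 R ≤ i2 R × i2 R < n × j1 R ≤ j2 R × j2 R < n

height width : Rect → ℕ
height R = suc (i2 R) ∸ i1 R
width  R = suc (j2 R) ∸ j1 R

module _ {S : Set} (A : ℕ → ℕ → S) where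

  HPeriod : Rect → ℕ → Set
  HPeriod R p = 1 ≤ p × (∀ i j → i1 R ≤ i → i ≤ i2 R → j1 R ≤ j → j + p ≤ j2 R → A i j ≡ A i (j + p))

  VPeriod : Rect → ℕ → Set
  VPeriod R q = 1 ≤ q × (∀ i j → i1 R ≤ i → i + q ≤ i2 R → j1 R ≤ j → j ≤ j2 R → A i j ≡ A (i + q) j)

  IsHper : Rect → ℕ → Set
  IsHper R p = HPeriod R p × (∀ q → q < p → ¬ HPeriod R q)

  IsVper : Rect → ℕ → Set
  IsVper R q = VPeriod R q × (∀ r → r < q → ¬ VPeriod R r)

  SamePeriods : Rect → Rect → Set
  SamePeriods R R' = ∃[ p ] ∃[ q ] (IsHper R p × IsHper R' p × IsVper R q × IsVper R' q)

  Is2DRun : ℕ → Rect → Set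
  Is2DRun n R =
    ValidIn n R ×
    (∃[ p ] (IsHper R p × 2 * p ≤ width R)) ×
    (∃[ q ] (IsVper R q × 2 * q ≤ height R)) ×
    (1 ≤ i1 R → ¬ SamePeriods R (rect (i1 R ∸ 1) (i2 R) (j1 R) (j2 R))) ×
    (suc (i2 R) < n → ¬ SamePeriods R (rect (i1 R) (suc (i2 R)) (j1 R) (j2 R))) ×
    (1 ≤ j1 R → ¬ SamePeriods R (rect (i1 R) (i2 R) (j1 R ∸ 1) (j2 R))) ×
    (suc (j2 R) < n → ¬ SamePeriods R (rect (i1 R) (i2 R) (j1 R) (suc (j2 R))))

{-# OPTIONS --safe #-}
module Submission where

-- A run with least periods p (horizontal) and q (vertical) is charged to a cell (i2, c) of its
-- bottom row, to the dyadic scales of p and q, and to a direction.  If i1 > 0, maximality at the top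
-- gives a column j of the run where row i1 - 1 breaks the period q.  If some such j has at least
-- 2p - 1 columns of the run to its left, then c = j (backward); otherwise c = j1 (forward).
-- Either way the 2p columns met by walking from c lie in the run, and row i1 - 1, if any, breaks q there.
-- Reading columns of the last 2 * 2^b rows as letters (2^b the scale of q), p is the half-length
-- of a square prefix with least period p, and among three such squares with u < v < w one has
-- w >= 2u; so a charge admits at most two values of p and, arguing likewise on rows, for each of
-- them at most two values of q.  The charge together with p and q determines the run: i1 by the
-- break above, j1 and j2 by maximality to the left and right.  This gives 2 * 2 * 2 runs per
-- cell and pair of scales.
-- Equality of letters need not be decidable, but the final inequality on naturals is, so the
-- existence of breaks is only needed under a double negation.

open import Defs
open import Data.Empty using (⊥)
open import Data.Fin using (Fin; zero; suc; toℕ; fromℕ<; combine)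
import Data.Fin.Properties as Fin
open import Data.List using (List; []; _∷_; length; lookup)
open import Data.List.Membership.Propositional.Properties using (∈-lookup)
import Data.List.Relation.Unary.All as All
open import Data.List.Relation.Unary.All using (All)
open import Data.List.Relation.Unary.AllPairs using (_∷_)
open import Data.List.Relation.Unary.Unique.Propositional using (Unique)
open import Data.Nat
open import Data.Nat.Induction using (<-wellFounded)
open import Data.Nat.Logarithm using (⌊log₂_⌋; ⌊log₂⌋-mono-≤; ⌊log₂[2^n]⌋≡n)
open import Data.Nat.Properties
open import Data.Nat.Tactic.RingSolver using (solve)
open import Data.Product using (_×_; _,_; ∃-syntax; proj₁; proj₂)
open import Data.Sum using (inj₁; inj₂)
open import Effect.Monad using (RawMonad)
open import Function using (_on_; flip)
open import Induction.WellFounded using (Acc; acc)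
open import Level using (0ℓ)
open import Relation.Binary using (Rel; IsEquivalence; tri<; tri≈; tri>)
import Relation.Binary.Construct.On as On
open import Relation.Binary.PropositionalEquality
open import Relation.Nullary using (¬_; Dec; yes; no; contradiction)
open import Relation.Nullary.Decidable using (decidable-stable; _×-dec_)
open import Relation.Nullary.Negation using (¬¬-Monad; ¬¬-map)

-- The slack e is what remains of b + l after cancelling a + r.
linear : ∀ {a b l r} e → l ≤ r → a + r + e ≡ b + l → a ≤ b
linear {a} {b} {l} {r} e l≤r eq = +-cancelʳ-≤ r a b (begin
  a + r     ≤⟨ m≤m+n (a + r) e ⟩
  a + r + e ≡⟨ eq ⟩
  b + l     ≤⟨ +-monoʳ-≤ b l≤r ⟩
  b + r     ∎)
  where open ≤-Reasoning

-- Steps of `p` lead from the base window to every position on its right, and from any position on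
-- its left into the known region. A bound from above, where needed, goes into `Q` as a premise.
window-induction : (Q : ℕ → Set) {l s p : ℕ} → 1 ≤ p →
  (∀ c → s ≤ c → Q c → Q (c + p)) →
  (∀ c → l ≤ c → c < s → Q (c + p) → Q c) →
  (∀ c → s ≤ c → c < s + p → Q c) →
  ∀ c → l ≤ c → Q c
window-induction Q {l} {s} {p} 1≤p up down base c₀ l≤c₀ = below s c₀ l≤c₀ (m≤n+m s c₀)
  where
  above : ∀ c → Acc _<_ c → s ≤ c → Q c
  above c (acc rec) s≤c with c <? s + p
  ... | yes c<s+p = base c s≤c c<s+p
  ... | no  c≮s+p with m≤n⇒∃[o]m+o≡n (≮⇒≥ c≮s+p)
  ...   | k , refl = subst Q (+-right s k p)
            (up (s + k) (m≤m+n s k) (above (s + k) (rec (linear 0 1≤p (solve (s ∷ k ∷ p ∷ [])))) (m≤m+n s k)))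
    where
    +-right : ∀ x y z → x + y + z ≡ x + z + y
    +-right x y z = solve (x ∷ y ∷ z ∷ [])

  -- `fuel` bounds the distance from `c` up to `s`; each step of `p` uses at least one unit.
  below : ∀ fuel c → l ≤ c → s ≤ c + fuel → Q c
  below zero       c l≤c s≤c+0 = above c (<-wellFounded c) (subst (s ≤_) (+-identityʳ c) s≤c+0)
  below (suc fuel) c l≤c s≤c+fuel with c <? s
  ... | no  c≮s = above c (<-wellFounded c) (≮⇒≥ c≮s)
  ... | yes c<s = down c l≤c c<s (below fuel (c + p) (≤-trans l≤c (m≤m+n c p))
                    (linear 0 (+-mono-≤ s≤c+fuel 1≤p) (solve (s ∷ c ∷ p ∷ fuel ∷ []))))

-- Periods and squares up to an equivalence of letters.

Per : Rel ℕ 0ℓ → ℕ → ℕ → Set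
Per E d N = ∀ x → x + d < N → E x (x + d)

-- Asking for the least period of the square, rather than for a primitive root, makes
-- three-squares below independent of the theorem of Fine and Wilf.
MinSquare : Rel ℕ 0ℓ → ℕ → Set
MinSquare E p = Per E p (p + p) × (∀ h → 1 ≤ h → h < p → ¬ Per E h (p + p))

module _ {E : Rel ℕ 0ℓ} (isEquivalence : IsEquivalence E) where
  private module E = IsEquivalence isEquivalence

  -- Both ends of a pair at distance `g` may be shifted by `d`, and `d + g ≤ m` puts the first `d`
  -- pairs inside the known prefix.
  Per-extend : ∀ {d g m N} → 1 ≤ d → d + g ≤ m → Per E d N → Per E g m → Per E g N
  Per-extend {d} {g} {m} {N} 1≤d d+g≤m perd perg x =
    window-induction (λ x → x + g < N → E x (x + g)) {s = 0} 1≤d up (λ _ _ ()) base x z≤n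
    where
    up : ∀ x → 0 ≤ x → (x + g < N → E x (x + g)) → x + d + g < N → E (x + d) (x + d + g)
    up x _ ih lt =
      E.trans (E.sym (perd x (≤-<-trans (m≤m+n (x + d) g) lt)))
        (E.trans (ih (≤-<-trans (linear {a = x + g} {b = x + d + g} 0 (z≤n {d}) (solve (x ∷ d ∷ g ∷ []))) lt))
          (subst (E (x + g)) eq (perd (x + g) (subst (_< N) (sym eq) lt))))
      where
      eq : x + g + d ≡ x + d + g
      eq = solve (x ∷ g ∷ d ∷ [])
    base : ∀ x → 0 ≤ x → x < 0 + d → x + g < N → E x (x + g)
    base x _ x<d _ = perg x (≤-trans (+-monoˡ-≤ g x<d) d+g≤m)

  -- One step of `v + d` up and one step of `v` down lead from `x` to `x + d`.
  Per-difference : ∀ v d → Per E v (v + v) → Per E (v + d) (v + d + (v + d)) → Per E d v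
  Per-difference v d perᵥ per x x+d<v =
    E.trans (per x (+-monoˡ-< (v + d) (≤-<-trans (m≤m+n x d) (m≤n⇒m≤n+o d x+d<v))))
      (E.sym (subst (E (x + d)) eq (perᵥ (x + d) (+-monoˡ-< v x+d<v))))
    where
    eq : x + d + v ≡ x + (v + d)
    eq = solve (x ∷ d ∷ v ∷ [])

  -- With v = u + e and w = u + e + d, comparing consecutive squares gives period d on [0, v)
  -- and period e on [0, u); the smaller of the two then spreads to the whole square of u.
  three-squares : ∀ u e d → 1 ≤ e → 1 ≤ d → e + d < u →
    MinSquare E u → Per E (u + e) (u + e + (u + e)) →
    Per E (u + e + d) (u + e + d + (u + e + d)) → ⊥
  three-squares u e d 1≤e 1≤d e+d<u (perᵤ , minᵤ) perᵥ perw with ≤-total d e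
  ... | inj₁ d≤e = minᵤ d 1≤d (≤-<-trans (m≤n+m d e) e+d<u)
                     (Per-extend (≤-trans (s≤s z≤n) e+d<u) (+-monoʳ-≤ u d≤e) perᵤ
                       (Per-difference (u + e) d perᵥ perw))
  -- Period `e` is known on [0, u) only: `d` carries it to [0, u + e), which is long enough for the
  -- period `u` to take over.
  ... | inj₂ e≤d = minᵤ e 1≤e (≤-<-trans (m≤m+n e d) e+d<u)
                     (Per-extend (≤-trans (s≤s z≤n) e+d<u) ≤-refl perᵤ
                       (Per-extend 1≤d (≤-trans (≤-reflexive (+-comm d e)) (<⇒≤ e+d<u))
                         (Per-difference (u + e) d perᵥ perw)
                         (Per-difference u e perᵤ perᵥ)))

-- Reading a word in either direction.

data Direction : Set where
  forward backward : Direction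

walk : Direction → ℕ → ℕ → ℕ
walk forward  c x = c + x
walk backward c x = c ∸ x

-- The 2p positions met by walking from c form the interval [s, s + 2p).
Window : Direction → ℕ → ℕ → ℕ → Set
Window forward  c p s = s ≡ c
Window backward c p s = s + (p + p) ≡ suc c

Window-unique : ∀ k {c p s s′} → Window k c p s → Window k c p s′ → s ≡ s′
Window-unique forward  w w′ = trans w (sym w′)
Window-unique backward {p = p} w w′ = +-cancelʳ-≡ (p + p) _ _ (trans w (sym w′))

module _ {F : Rel ℕ 0ℓ} (isEquivalence : IsEquivalence F) where
  private module F = IsEquivalence isEquivalence

  -- Walking backward reverses the pair (j, j + h), hence the use of symmetry; `x` is then the
  -- distance from `j + h` to `c`.
  walk⇒window : ∀ k {c p s h} → Window k c p s → Per (F on walk k c) h (p + p) →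
    ∀ j → s ≤ j → j + h < s + (p + p) → F j (j + h)
  walk⇒window forward {p = p} {s} {h} refl per j s≤j j+h< with m≤n⇒∃[o]m+o≡n s≤j
  ... | x , refl = subst (F (s + x)) (sym (+-assoc s x h))
                     (per x (+-cancelˡ-< s _ _ (subst (_< s + (p + p)) (+-assoc s x h) j+h<)))
  walk⇒window backward {c} {p} {s} {h} w per j s≤j j+h<
    with m≤n⇒∃[o]m+o≡n (s≤s⁻¹ (subst (j + h <_) w j+h<))
  ... | x , refl = F.sym (subst₂ F (m+n∸n≡m (j + h) x) eq (per x x+h<))
    where
    x+h< : x + h < p + p
    x+h< = linear 0 (+-mono-≤ s≤j (≤-reflexive (sym w))) (solve (s ∷ j ∷ h ∷ x ∷ p ∷ []))
    eq : j + h + x ∸ (x + h) ≡ j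
    eq = trans (cong (_∸ (x + h)) (trans (+-assoc j h x) (cong (j +_) (+-comm h x)))) (m+n∸n≡m j (x + h))

  window⇒walk : ∀ k {c p s h} → Window k c p s →
    (∀ j → s ≤ j → j + h < s + (p + p) → F j (j + h)) → Per (F on walk k c) h (p + p)
  window⇒walk forward {p = p} {s} {h} refl per x x+h< =
    subst (F (s + x)) (+-assoc s x h)
      (per (s + x) (m≤m+n s x) (subst (_< s + (p + p)) (sym (+-assoc s x h)) (+-monoʳ-< s x+h<)))
  window⇒walk backward {c} {p} {s} {h} w per x x+h<
    with m≤n⇒∃[o]m+o≡n {x + h} {c} (s≤s⁻¹ (≤-trans x+h< (≤-trans (m≤n+m (p + p) s) (≤-reflexive w))))
  ... | j , refl = F.sym (subst₂ F (sym (m+n∸m≡n (x + h) j)) (sym eq) (per j s≤j j+h<))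
    where
    s≤j : s ≤ j
    s≤j = linear 0 (+-mono-≤ x+h< (≤-reflexive w)) (solve (s ∷ j ∷ h ∷ x ∷ p ∷ []))
    j+h< : j + h < s + (p + p)
    j+h< = linear x (≤-reflexive (sym w)) (solve (s ∷ j ∷ h ∷ x ∷ p ∷ []))
    eq : x + h + j ∸ x ≡ j + h
    eq = trans (cong (_∸ x) (+-assoc x h j)) (trans (m+n∸m≡n x (h + j)) (+-comm h j))

-- From local to global periods.

-- The period `p` carries the shift `h` along `q` consecutive rows, then the period `q` carries it
-- to the other rows. Hence a least period of a run stays least on a small patch.
spread : ∀ {S : Set} (B : ℕ → ℕ → S) {r₁ r₂ c₁ c₂ p q h s t} → 1 ≤ p → 1 ≤ q →
  (∀ i j → r₁ ≤ i → i ≤ r₂ → c₁ ≤ j → j + p ≤ c₂ → B i j ≡ B i (j + p)) →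
  (∀ i j → r₁ ≤ i → i + q ≤ r₂ → c₁ ≤ j → j ≤ c₂ → B i j ≡ B (i + q) j) →
  h ≤ p → c₁ ≤ s → s + (p + p) ≤ suc c₂ → r₁ ≤ t → t + q ≤ suc r₂ →
  (∀ i j → t ≤ i → i < t + q → s ≤ j → j + h < s + (p + p) → B i j ≡ B i (j + h)) →
  ∀ i j → r₁ ≤ i → i ≤ r₂ → c₁ ≤ j → j + h ≤ c₂ → B i j ≡ B i (j + h)
spread B {r₁} {r₂} {c₁} {c₂} {p} {q} {h} {s} {t} 1≤p 1≤q hp vp h≤p c₁≤s s+2p≤ r₁≤t t+q≤ local
  i₀ j₀ r₁≤i₀ i₀≤r₂ c₁≤j₀ j₀+h≤c₂ =
  window-induction (λ i → i ≤ r₂ → ∀ j → c₁ ≤ j → j + h ≤ c₂ → B i j ≡ B i (j + h)) 1≤q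
    (λ i t≤i ih i+q≤ j c₁≤j j+h≤ →
      trans (sym (vp i j (≤-trans r₁≤t t≤i) i+q≤ c₁≤j (m+n≤o⇒m≤o j j+h≤)))
        (trans (ih (m+n≤o⇒m≤o i i+q≤) j c₁≤j j+h≤)
          (vp i (j + h) (≤-trans r₁≤t t≤i) i+q≤ (m≤n⇒m≤n+o h c₁≤j) j+h≤)))
    (λ i r₁≤i i<t ih i≤r₂ j c₁≤j j+h≤ →
      let i+q≤ = s≤s⁻¹ (≤-trans (+-monoˡ-< q i<t) t+q≤) in
      trans (vp i j r₁≤i i+q≤ c₁≤j (m+n≤o⇒m≤o j j+h≤))
        (trans (ih i+q≤ j c₁≤j j+h≤)
          (sym (vp i (j + h) r₁≤i i+q≤ (m≤n⇒m≤n+o h c₁≤j) j+h≤))))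
    (λ i t≤i i<t+q i≤r₂ → along i t≤i i<t+q (≤-trans r₁≤t t≤i) i≤r₂)
    i₀ r₁≤i₀ i₀≤r₂ j₀ c₁≤j₀ j₀+h≤c₂
  where
  swap : ∀ x y z → x + y + z ≡ x + z + y
  swap x y z = solve (x ∷ y ∷ z ∷ [])

  along : ∀ i → t ≤ i → i < t + q → r₁ ≤ i → i ≤ r₂ → ∀ j → c₁ ≤ j → j + h ≤ c₂ → B i j ≡ B i (j + h)
  along i t≤i i<t+q r₁≤i i≤r₂ =
    window-induction (λ j → j + h ≤ c₂ → B i j ≡ B i (j + h)) 1≤p
      (λ j s≤j ih j+p+h≤ →
        let j+h+p≤ = subst (_≤ c₂) (swap j p h) j+p+h≤ in
        trans (sym (hp i j r₁≤i i≤r₂ (≤-trans c₁≤s s≤j) (m+n≤o⇒m≤o (j + p) j+p+h≤)))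
          (trans (ih (m+n≤o⇒m≤o (j + h) j+h+p≤))
            (trans (hp i (j + h) r₁≤i i≤r₂ (m≤n⇒m≤n+o h (≤-trans c₁≤s s≤j)) j+h+p≤)
              (cong (B i) (swap j h p)))))
      (λ j c₁≤j j<s ih j+h≤ →
        -- For `j` left of the window, `h ≤ p` keeps `j + p + h` before the end of its 2p columns.
        let j+p+h≤ : j + p + h ≤ c₂
            j+p+h≤ = linear 0 (+-mono-≤ j<s (+-mono-≤ h≤p s+2p≤))
                       (solve (j ∷ p ∷ h ∷ c₂ ∷ s ∷ []))
        in
        trans (hp i j r₁≤i i≤r₂ c₁≤j (m+n≤o⇒m≤o (j + p) j+p+h≤))
          (trans (ih j+p+h≤)
            (trans (cong (B i) (swap j p h))
              (sym (hp i (j + h) r₁≤i i≤r₂ (m≤n⇒m≤n+o h c₁≤j) (subst (_≤ c₂) (swap j p h) j+p+h≤))))))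
      (λ j s≤j j<s+p _ → local i j t≤i i<t+q s≤j
        (linear 0 (+-mono-≤ j<s+p h≤p) (solve (j ∷ p ∷ h ∷ s ∷ []))))

-- Finite conjunctions under double negation.

¬¬-sequence : ∀ {m} {P : Fin m → Set} → (∀ x → ¬ ¬ P x) → ¬ ¬ (∀ x → P x)
¬¬-sequence = Fin.sequence (RawMonad.rawApplicative ¬¬-Monad)

¬¬-range : ∀ {P : ℕ → Set} l r → (∀ j → l ≤ j → j ≤ r → ¬ ¬ P j) → ¬ ¬ (∀ j → l ≤ j → j ≤ r → P j)
¬¬-range {P} l r ¬¬P = ¬¬-map
  (λ all j l≤j j≤r → subst (λ x → l ≤ x → P x) (Fin.toℕ-fromℕ< (s≤s j≤r)) (all (fromℕ< (s≤s j≤r))) l≤j)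
  (¬¬-sequence pointwise)
  where
  pointwise : (x : Fin (suc r)) → ¬ ¬ (l ≤ toℕ x → P (toℕ x))
  pointwise x with l ≤? toℕ x
  ... | yes l≤x = ¬¬-map (λ Px _ → Px) (¬¬P (toℕ x) l≤x (s≤s⁻¹ (Fin.toℕ<n x)))
  ... | no  l≰x = λ k → k (λ l≤x → contradiction l≤x l≰x)

-- Charges and the squares they carry.

module _ {S : Set} (A : ℕ → ℕ → S) where

  Strip : ℕ → ℕ → Rel ℕ 0ℓ
  Strip b w j j′ = ∀ i → i ≤ b → b < i + w → A i j ≡ A i j′

  Block : ℕ → ℕ → Rel ℕ 0ℓ
  Block s w i i′ = ∀ j → s ≤ j → j < s + w → A i j ≡ A i′ j

  Strip-isEquivalence : ∀ b w → IsEquivalence (Strip b w)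
  Strip-isEquivalence b w = record
    { refl  = λ _ _ _ → refl
    ; sym   = λ e i i≤b b< → sym (e i i≤b b<)
    ; trans = λ e e′ i i≤b b< → trans (e i i≤b b<) (e′ i i≤b b<)
    }

  Block-isEquivalence : ∀ s w → IsEquivalence (Block s w)
  Block-isEquivalence s w = record
    { refl  = λ _ _ _ → refl
    ; sym   = λ e j s≤j j< → sym (e j s≤j j<)
    ; trans = λ e e′ j s≤j j< → trans (e j s≤j j<) (e′ j s≤j j<)
    }

  -- `broken` concerns the window only, which `k`, `c` and `p` determine, so it can be compared
  -- between runs. Equations such as `suc t ≡ i1 R` make the conditions vacuous at the border.
  record Charged (n : ℕ) (R : Rect) (p q : ℕ) (k : Direction) (c : ℕ) : Set where
    field
      hper      : IsHper A R p
      vper      : IsVper A R q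
      bottom<n  : i2 R < n
      right<n   : j2 R < n
      c≤right   : c ≤ j2 R
      tall      : i1 R + (q + q) ≤ suc (i2 R)
      start     : ℕ
      window    : Window k c p start
      left≤     : j1 R ≤ start
      ≤right    : start + (p + p) ≤ suc (j2 R)
      broken    : ∀ {t} → suc t ≡ i1 R → ¬ (∀ j → start ≤ j → j < start + (p + p) → A t j ≡ A (t + q) j)
      leftMax   : ∀ {l} → suc l ≡ j1 R → ¬ (∀ i → i1 R ≤ i → i ≤ i2 R → A i l ≡ A i (l + p))
      rightMax  : ∀ {j} → j + p ≡ suc (j2 R) → suc (j2 R) < n →
                  ¬ (∀ i → i1 R ≤ i → i ≤ i2 R → A i j ≡ A i (j + p))

  open Charged

  -- `w ≤ q + q` keeps the strip inside the run; `q ≤ w` makes it contain a full vertical period,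
  -- from which a shorter horizontal period would spread to the whole run.
  hper-minSquare : ∀ {n R p q k c w} → Charged n R p q k c → q ≤ w → w ≤ q + q →
    MinSquare (Strip (i2 R) w on walk k c) p
  hper-minSquare {n} {R@(rect t b l r)} {p} {q} {k} {c} {w} C q≤w w≤2q =
      window⇒walk (Strip-isEquivalence b w) k (window C) per
    , λ h 1≤h h<p perₕ → proj₂ (hper C) h h<p
        (1≤h , spread A 1≤p 1≤q hp vp (<⇒≤ h<p) (left≤ C) (≤right C) t≤t′ (≤-reflexive t′+q≡)
          (λ i j t′≤i i<t′+q s≤j j+h< →
            walk⇒window (Strip-isEquivalence b w) k (window C) perₕ j s≤j j+h< i
              (s≤s⁻¹ (≤-trans i<t′+q (≤-reflexive t′+q≡)))
              (≤-trans (≤-reflexive (sym t′+q≡)) (+-mono-≤ t′≤i q≤w))))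
    where
    1≤p = proj₁ (proj₁ (hper C))
    1≤q = proj₁ (proj₁ (vper C))
    hp  = proj₂ (proj₁ (hper C))
    vp  = proj₂ (proj₁ (vper C))
    t′ = suc b ∸ q
    t′+q≡ : t′ + q ≡ suc b
    t′+q≡ = m∸n+n≡m (≤-trans (m≤n+m q q) (≤-trans (m≤n+m (q + q) t) (tall C)))
    t≤t′ : t ≤ t′
    t≤t′ = m+n≤o⇒m≤o∸n t (≤-trans (+-monoʳ-≤ t (m≤m+n q q)) (tall C))
    per : ∀ j → start C ≤ j → j + p < start C + (p + p) → Strip b w j (j + p)
    per j s≤j j+p< i i≤b b<i+w = hp i j
      (+-cancelʳ-≤ (q + q) t i (≤-trans (tall C) (≤-trans b<i+w (+-monoʳ-≤ i w≤2q))))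
      i≤b (≤-trans (left≤ C) s≤j) (s≤s⁻¹ (≤-trans j+p< (≤right C)))

  -- Rows are now the letters. They are read upward from the bottom row, which the charge fixes.
  vper-minSquare : ∀ {n R p q k c} (C : Charged n R p q k c) →
    MinSquare (Block (start C) (p + p) on walk backward (i2 R)) q
  vper-minSquare {n} {R@(rect t b l r)} {p} {q} {k} {c} C =
      window⇒walk (Block-isEquivalence s (p + p)) backward {p = q} t′+2q≡ per
    , λ h 1≤h h<q perₕ → proj₂ (vper C) h h<q
        (1≤h , λ i j t≤i i+h≤b l≤j j≤r →
          spread (flip A) 1≤q 1≤p (λ j i l≤j j≤r t≤i i+q≤b → vp i j t≤i i+q≤b l≤j j≤r)
            (λ j i l≤j j+p≤r t≤i i≤b → hp i j t≤i i≤b l≤j j+p≤r)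
            (<⇒≤ h<q) t≤t′ (≤-reflexive t′+2q≡) (left≤ C)
            (≤-trans (+-monoʳ-≤ s (m≤m+n p p)) (≤right C))
            (λ j i s≤j j<s+p t′≤i i+h< →
              walk⇒window (Block-isEquivalence s (p + p)) backward {p = q} t′+2q≡ perₕ i t′≤i i+h<
                j s≤j (≤-trans j<s+p (+-monoʳ-≤ s (m≤m+n p p))))
            j i l≤j j≤r t≤i i+h≤b)
    where
    1≤p = proj₁ (proj₁ (hper C))
    1≤q = proj₁ (proj₁ (vper C))
    hp  = proj₂ (proj₁ (hper C))
    vp  = proj₂ (proj₁ (vper C))
    s = start C
    t′ = suc b ∸ (q + q)
    t′+2q≡ : t′ + (q + q) ≡ suc b
    t′+2q≡ = m∸n+n≡m (≤-trans (m≤n+m (q + q) t) (tall C))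
    t≤t′ : t ≤ t′
    t≤t′ = m+n≤o⇒m≤o∸n t (tall C)
    per : ∀ i → t′ ≤ i → i + q < t′ + (q + q) → Block s (p + p) i (i + q)
    per i t′≤i i+q< j s≤j j< = vp i j (≤-trans t≤t′ t′≤i) (s≤s⁻¹ (≤-trans i+q< (≤-reflexive t′+2q≡)))
      (≤-trans (left≤ C) s≤j) (s≤s⁻¹ (≤-trans j< (≤right C)))

  -- A charge with its periods determines the run.

  module _ {n t b l r t′ l′ r′ p q k c}
           (C : Charged n (rect t b l r) p q k c) (C′ : Charged n (rect t′ b l′ r′) p q k c) where

    -- Otherwise the row above the second run lies in the first, where `q` holds throughout the
    -- common window.
    ¬taller : ¬ (t < t′)
    ¬taller t<t′ with m≤n⇒∃[o]m+o≡n t<t′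
    ... | d , refl = broken C′ refl λ j s≤j j< → proj₂ (proj₁ (vper C)) (t + d) j
      (m≤m+n t d)
      (linear q (tall C′) (solve (t ∷ d ∷ q ∷ b ∷ [])))
      (≤-trans (left≤ C) (≤-trans (≤-reflexive s≡s′) s≤j))
      (s≤s⁻¹ (≤-trans j< (≤-trans (≤-reflexive (cong (_+ (p + p)) (sym s≡s′))) (≤right C))))
      where
      s≡s′ = Window-unique k (window C) (window C′)

  module _ {n t b l r l′ r′ p q k c}
           (C : Charged n (rect t b l r) p q k c) (C′ : Charged n (rect t b l′ r′) p q k c) where
    private
      s≡s′ = Window-unique k (window C) (window C′)
      hp′ = proj₂ (proj₁ (hper C′))

    ¬further-left : ¬ (l′ < l)
    ¬further-left l′<l with m≤n⇒∃[o]m+o≡n l′<l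
    ... | d , refl = leftMax C refl λ i t≤i i≤b → hp′ i (l′ + d) t≤i i≤b (m≤m+n l′ d)
      (s≤s⁻¹ (≤-trans (+-mono-≤ (left≤ C) (m≤m+n p p))
        (≤-trans (≤-reflexive (cong (_+ (p + p)) s≡s′)) (≤right C′))))

    ¬further-right : ¬ (r < r′)
    ¬further-right r<r′ = rightMax C {suc r ∸ p} eq (≤-<-trans r<r′ (right<n C′)) λ i t≤i i≤b →
      hp′ i (suc r ∸ p) t≤i i≤b (m+n≤o⇒m≤o∸n l′ l′+p≤) (subst (_≤ r′) (sym eq) r<r′)
      where
      l′+p≤ : l′ + p ≤ suc r
      l′+p≤ = ≤-trans (+-mono-≤ (left≤ C′) (m≤m+n p p))
                (≤-trans (≤-reflexive (cong (_+ (p + p)) (sym s≡s′))) (≤right C))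
      eq : suc r ∸ p + p ≡ suc r
      eq = m∸n+n≡m (≤-trans (m≤n+m p l′) l′+p≤)

  Charged-injective : ∀ {n R R′ p p′ q q′ k k′ c c′} → Charged n R p q k c → Charged n R′ p′ q′ k′ c′ →
    i2 R ≡ i2 R′ → p ≡ p′ → q ≡ q′ → k ≡ k′ → c ≡ c′ → R ≡ R′
  -- Top rows are compared first, because the breaks at the left and right concern all rows of the
  -- run.
  Charged-injective {R = rect t b l r} {rect t′ b l′ r′} C C′ refl refl refl refl refl with <-cmp t t′
  ... | tri< t<t′ _ _ = contradiction t<t′ (¬taller C C′)
  ... | tri> _ _ t>t′ = contradiction t>t′ (¬taller C′ C)
  ... | tri≈ _ refl _ with <-cmp l l′ | <-cmp r r′
  ...   | tri< l<l′ _ _ | _ = contradiction l<l′ (¬further-left C′ C)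
  ...   | tri> _ _ l>l′ | _ = contradiction l>l′ (¬further-left C C′)
  ...   | tri≈ _ _ _ | tri< r<r′ _ _ = contradiction r<r′ (¬further-right C C′)
  ...   | tri≈ _ _ _ | tri> _ _ r>r′ = contradiction r>r′ (¬further-right C′ C)
  ...   | tri≈ _ refl _ | tri≈ _ refl _ = refl

  -- Extensions that keep both periods.

  -- Minimality passes to the larger rectangle, since a shorter period there would restrict to the
  -- smaller one.
  samePeriods : ∀ {R R′ p q} → i1 R′ ≤ i1 R → i2 R ≤ i2 R′ → j1 R′ ≤ j1 R → j2 R ≤ j2 R′ →
    IsHper A R p → IsVper A R q → HPeriod A R′ p → VPeriod A R′ q → SamePeriods A R R′
  samePeriods t′≤t b≤b′ l′≤l r≤r′ hper@(_ , hmin) vper@(_ , vmin) hp′ vp′ =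
    _ , _ , hper
    , (hp′ , λ h h<p (1≤h , eq) → hmin h h<p (1≤h , λ i j t≤i i≤b l≤j j+h≤r →
        eq i j (≤-trans t′≤t t≤i) (≤-trans i≤b b≤b′) (≤-trans l′≤l l≤j) (≤-trans j+h≤r r≤r′)))
    , vper
    , (vp′ , λ h h<q (1≤h , eq) → vmin h h<q (1≤h , λ i j t≤i i+h≤b l≤j j≤r →
        eq i j (≤-trans t′≤t t≤i) (≤-trans i+h≤b b≤b′) (≤-trans l′≤l l≤j) (≤-trans j≤r r≤r′)))

  module _ {t b l r p q} (hper : IsHper A (rect t b l r) p) (vper : IsVper A (rect t b l r) q)
           (wide : l + (p + p) ≤ suc r) (tall : t + (q + q) ≤ suc b) where
    private
      1≤p = proj₁ (proj₁ hper)
      1≤q = proj₁ (proj₁ vper)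
      hp  = proj₂ (proj₁ hper)
      vp  = proj₂ (proj₁ vper)

    -- The new row repeats row `t′ + q`, which `tall` places in the run, and so inherits the period
    -- `p`.
    samePeriods-top : ∀ {t′} → suc t′ ≡ t → (∀ j → l ≤ j → j ≤ r → A t′ j ≡ A (t′ + q) j) →
      SamePeriods A (rect t b l r) (rect t′ b l r)
    samePeriods-top {t′} refl eq = samePeriods (n≤1+n t′) ≤-refl ≤-refl ≤-refl hper vper
      (1≤p , hp′) (1≤q , vp′)
      where
      t′+q≤b : t′ + q ≤ b
      t′+q≤b = linear q tall (solve (t′ ∷ q ∷ b ∷ []))
      t≤t′+q : suc t′ ≤ t′ + q
      t≤t′+q = linear 0 1≤q (solve (t′ ∷ q ∷ []))
      hp′ : ∀ i j → t′ ≤ i → i ≤ b → l ≤ j → j + p ≤ r → A i j ≡ A i (j + p)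
      hp′ i j t′≤i i≤b l≤j j+p≤r with m≤n⇒m<n∨m≡n t′≤i
      ... | inj₁ t≤i  = hp i j t≤i i≤b l≤j j+p≤r
      ... | inj₂ refl = trans (eq j l≤j (m+n≤o⇒m≤o j j+p≤r))
                          (trans (hp (t′ + q) j t≤t′+q t′+q≤b l≤j j+p≤r)
                            (sym (eq (j + p) (m≤n⇒m≤n+o p l≤j) j+p≤r)))
      vp′ : ∀ i j → t′ ≤ i → i + q ≤ b → l ≤ j → j ≤ r → A i j ≡ A (i + q) j
      vp′ i j t′≤i i+q≤b l≤j j≤r with m≤n⇒m<n∨m≡n t′≤i
      ... | inj₁ t≤i  = vp i j t≤i i+q≤b l≤j j≤r
      ... | inj₂ refl = eq j l≤j j≤r

    samePeriods-left : ∀ {l′} → suc l′ ≡ l → (∀ i → t ≤ i → i ≤ b → A i l′ ≡ A i (l′ + p)) →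
      SamePeriods A (rect t b l r) (rect t b l′ r)
    samePeriods-left {l′} refl eq = samePeriods ≤-refl ≤-refl (n≤1+n l′) ≤-refl hper vper
      (1≤p , hp′) (1≤q , vp′)
      where
      l′+p≤r : l′ + p ≤ r
      l′+p≤r = linear p wide (solve (l′ ∷ p ∷ r ∷ []))
      l≤l′+p : suc l′ ≤ l′ + p
      l≤l′+p = linear 0 1≤p (solve (l′ ∷ p ∷ []))
      hp′ : ∀ i j → t ≤ i → i ≤ b → l′ ≤ j → j + p ≤ r → A i j ≡ A i (j + p)
      hp′ i j t≤i i≤b l′≤j j+p≤r with m≤n⇒m<n∨m≡n l′≤j
      ... | inj₁ l≤j  = hp i j t≤i i≤b l≤j j+p≤r
      ... | inj₂ refl = eq i t≤i i≤b
      vp′ : ∀ i j → t ≤ i → i + q ≤ b → l′ ≤ j → j ≤ r → A i j ≡ A (i + q) j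
      vp′ i j t≤i i+q≤b l′≤j j≤r with m≤n⇒m<n∨m≡n l′≤j
      ... | inj₁ l≤j  = vp i j t≤i i+q≤b l≤j j≤r
      ... | inj₂ refl = trans (eq i t≤i (m+n≤o⇒m≤o i i+q≤b))
                          (trans (vp i (l′ + p) t≤i i+q≤b l≤l′+p l′+p≤r)
                            (sym (eq (i + q) (m≤n⇒m≤n+o q t≤i) i+q≤b)))

    samePeriods-right : ∀ {j₀} → j₀ + p ≡ suc r → (∀ i → t ≤ i → i ≤ b → A i j₀ ≡ A i (j₀ + p)) →
      SamePeriods A (rect t b l r) (rect t b l (suc r))
    samePeriods-right {j₀} j₀+p≡ eq = samePeriods ≤-refl ≤-refl ≤-refl (n≤1+n r) hper vper
      (1≤p , hp′) (1≤q , vp′)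
      where
      l≤j₀ : l ≤ j₀
      l≤j₀ = linear p (+-mono-≤ wide (≤-reflexive (sym j₀+p≡))) (solve (l ∷ p ∷ r ∷ j₀ ∷ []))
      j₀≤r : j₀ ≤ r
      j₀≤r = linear 0 (+-mono-≤ 1≤p (≤-reflexive j₀+p≡)) (solve (p ∷ r ∷ j₀ ∷ []))
      hp′ : ∀ i j → t ≤ i → i ≤ b → l ≤ j → j + p ≤ suc r → A i j ≡ A i (j + p)
      hp′ i j t≤i i≤b l≤j j+p≤ with m≤n⇒m<n∨m≡n j+p≤
      ... | inj₁ j+p≤r = hp i j t≤i i≤b l≤j (s≤s⁻¹ j+p≤r)
      ... | inj₂ j+p≡ with +-cancelʳ-≡ p j j₀ (trans j+p≡ (sym j₀+p≡))
      ...   | refl = eq i t≤i i≤b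
      vp′ : ∀ i j → t ≤ i → i + q ≤ b → l ≤ j → j ≤ suc r → A i j ≡ A (i + q) j
      vp′ i j t≤i i+q≤b l≤j j≤ with m≤n⇒m<n∨m≡n j≤
      ... | inj₁ j≤r  = vp i j t≤i i+q≤b l≤j (s≤s⁻¹ j≤r)
      ... | inj₂ refl = subst (λ c → A i c ≡ A (i + q) c) j₀+p≡
                          (trans (sym (eq i t≤i (m+n≤o⇒m≤o i i+q≤b)))
                            (trans (vp i j₀ t≤i i+q≤b l≤j₀ j₀≤r)
                              (eq (i + q) (m≤n⇒m≤n+o q t≤i) i+q≤b)))

  -- Every run has a charge.

  charge : ∀ {n R} → Is2DRun A n R →
    ¬ ¬ (∃[ p ] ∃[ q ] ∃[ k ] ∃[ c ] Charged n R p q k c)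
  charge {n} {rect t b l r} ((t≤b , b<n , l≤r , r<n) , (p , hper , 2p≤) , (q , vper , 2q≤) , top , _ , left , right) =
    anchored t refl
    where
    1≤p = proj₁ (proj₁ hper)
    double≤ : ∀ {x y} m → x ≤ y → 2 * m ≤ suc y ∸ x → x + (m + m) ≤ suc y
    double≤ {x} {y} m x≤y le =
      linear 0 (m≤o∸n⇒m+n≤o (2 * m) (m≤n⇒m≤1+n x≤y) le) (solve (m ∷ x ∷ y ∷ []))
    wide = double≤ p l≤r 2p≤
    high = double≤ q t≤b 2q≤
    anchor : ∀ k c s → Window k c p s → c ≤ r → l ≤ s → s + (p + p) ≤ suc r →
      (∀ {t′} → suc t′ ≡ t → ¬ (∀ j → s ≤ j → j < s + (p + p) → A t′ j ≡ A (t′ + q) j)) →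
      ∃[ p ] ∃[ q ] ∃[ k ] ∃[ c ] Charged n (rect t b l r) p q k c
    anchor k c s window c≤r l≤s s+2p≤ broken = p , q , k , c , record
      { hper     = hper
      ; vper     = vper
      ; bottom<n = b<n
      ; right<n  = r<n
      ; c≤right  = c≤r
      ; tall     = high
      ; start    = s
      ; window   = window
      ; left≤    = l≤s
      ; ≤right   = s+2p≤
      ; broken   = broken
      ; leftMax  = λ { refl eq → left (s≤s z≤n) (samePeriods-left hper vper wide high refl eq) }
      ; rightMax = λ j+p≡ r+1<n eq → right r+1<n (samePeriods-right hper vper wide high j+p≡ eq)
      }
    anchored : ∀ t₀ → t₀ ≡ t → ¬ ¬ (∃[ p ] ∃[ q ] ∃[ k ] ∃[ c ] Charged n (rect t b l r) p q k c)
    anchored zero refl none =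
      none (anchor forward l l refl l≤r ≤-refl wide λ ())
    -- Without a charge no column breaks `q`, and adding the row above would keep both periods.
    anchored (suc t′) refl none = ¬¬-range l r ¬¬eq λ eq →
      top (s≤s z≤n) (samePeriods-top hper vper wide high refl eq)
      where
      ¬¬eq : ∀ j → l ≤ j → j ≤ r → ¬ ¬ (A t′ j ≡ A (t′ + q) j)
      -- The test asks whether 2p columns of the run end at `j`; if not, `j` is among the first 2p
      -- columns.
      ¬¬eq j l≤j j≤r j-breaks with l + (p + p) ≤? suc j
      ... | no  far  = none (anchor forward l l refl l≤r ≤-refl wide
                         λ { refl eq → j-breaks (eq j l≤j (<-trans (n<1+n j) (≰⇒> far))) })
      ... | yes near = none (anchor backward j s s+2p≡ j≤r (m+n≤o⇒m≤o∸n l near)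
                         (≤-trans (≤-reflexive s+2p≡) (s≤s j≤r))
                         λ { refl eq → j-breaks (eq j s≤j (≤-reflexive (sym s+2p≡))) })
        where
        s = suc j ∸ (p + p)
        s+2p≡ : s + (p + p) ≡ suc j
        s+2p≡ = m∸n+n≡m (≤-trans (m≤n+m (p + p) l) near)
        s≤j : s ≤ j
        s≤j = ∸-monoʳ-≤ (suc j) (≤-trans 1≤p (m≤m+n p p))

-- Classes and scales.

no-three-squares : ∀ {E : Rel ℕ 0ℓ} → IsEquivalence E → ∀ {u v w} →
  MinSquare E u → Per E v (v + v) → Per E w (w + w) → u < v → v < w → w < u + u → ⊥
no-three-squares eqv {u} minᵤ perᵥ perw u<v v<w w<2u with m≤n⇒∃[o]m+o≡n (<⇒≤ u<v)
... | e , refl with m≤n⇒∃[o]m+o≡n (<⇒≤ v<w)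
...   | d , refl = three-squares eqv u e d
          (+-cancelˡ-≤ u 1 e (≤-trans (≤-reflexive (+-comm u 1)) u<v))
          (+-cancelˡ-≤ (u + e) 1 d (≤-trans (≤-reflexive (+-comm (u + e) 1)) v<w))
          (+-cancelˡ-< u (e + d) u (≤-<-trans (≤-reflexive (sym (+-assoc u e d))) w<2u))
          minᵤ perᵥ perw

-- The extra bit records whether the class of K has a smaller value of f.
refine : ∀ {m k} (K : Fin m → Fin k) (f : Fin m → ℕ) →
  (∀ x y z → K x ≡ K y → K x ≡ K z → f x < f y → f y < f z → ⊥) →
  ∃[ K′ ] (∀ x y → K′ x ≡ K′ y → K x ≡ K y × f x ≡ f y)
refine {m} {k} K f ¬three = (λ x → combine (K x) (bit (smaller? x))) , separates
  where
  Smaller : Fin m → Set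
  Smaller x = ∃[ y ] (K y ≡ K x × f y < f x)
  smaller? : ∀ x → Dec (Smaller x)
  smaller? x = Fin.any? λ y → (K y Fin.≟ K x) ×-dec (f y <? f x)
  bit : ∀ {P : Set} → Dec P → Fin 2
  bit (yes _) = suc zero
  bit (no  _) = zero
  ¬less : ∀ x y → K x ≡ K y → bit (smaller? x) ≡ bit (smaller? y) → ¬ (f x < f y)
  ¬less x y Kx≡Ky bits fx<fy with smaller? x | smaller? y
  -- A value below `f x` gives a chain of three; if there is none, `x` itself shows that the bit of
  -- `y` differs.
  ... | yes (z , Kz≡Kx , fz<fx) | _ = ¬three z x y Kz≡Kx (trans Kz≡Kx Kx≡Ky) fz<fx fx<fy
  ... | no _ | no none = none (x , Kx≡Ky , fx<fy)
  ... | no _ | yes _   = contradiction bits λ ()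
  separates : ∀ x y → combine (K x) (bit (smaller? x)) ≡ combine (K y) (bit (smaller? y)) →
    K x ≡ K y × f x ≡ f y
  separates x y same with Fin.combine-injective (K x) (bit (smaller? x)) (K y) (bit (smaller? y)) same
  ... | Kx≡Ky , bits with <-cmp (f x) (f y)
  ...   | tri< lt _ _ = contradiction lt (¬less x y Kx≡Ky bits)
  ...   | tri≈ _ eq _ = Kx≡Ky , eq
  ...   | tri> _ _ gt = contradiction gt (¬less y x (sym Kx≡Ky) (sym bits))

dyadic-scale : ∀ p → 1 ≤ p → ∃[ a ] (2 ^ a ≤ p × p < 2 ^ a + 2 ^ a)
dyadic-scale (suc zero)    _ = 0 , ≤-refl , ≤-refl
dyadic-scale (suc (suc p)) _ with dyadic-scale (suc p) (s≤s z≤n)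
... | a , lo , hi with m≤n⇒m<n∨m≡n hi
...   | inj₁ hi′ = a , m≤n⇒m≤1+n lo , hi′
...   | inj₂ eq  = suc a , ≤-reflexive (trans (cong (2 ^ a +_) (+-identityʳ (2 ^ a))) (sym eq))
                 , ≤-trans (≤-reflexive (cong suc eq)) (grow (2 ^ a) (m^n>0 2 a))
  where
  grow : ∀ x → 1 ≤ x → suc (x + x) ≤ 2 * x + 2 * x
  grow x 1≤x = linear x 1≤x (solve (x ∷ []))

-- Since 2p fits into `n`, so does the next power of two; strictness leaves only ⌊log₂ n⌋ scales.
scale<log : ∀ {a p n} → 2 ^ a ≤ p → p + p ≤ n → a < ⌊log₂ n ⌋
scale<log {a} {p} {n} lo 2p≤n = begin
  suc a                ≡⟨ ⌊log₂[2^n]⌋≡n (suc a) ⟨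
  ⌊log₂ 2 ^ suc a ⌋   ≤⟨ ⌊log₂⌋-mono-≤ 2^[1+a]≤n ⟩
  ⌊log₂ n ⌋            ∎
  where
  open ≤-Reasoning
  2^[1+a]≤n : 2 ^ suc a ≤ n
  2^[1+a]≤n = begin
    2 ^ a + (2 ^ a + 0) ≡⟨ cong (2 ^ a +_) (+-identityʳ (2 ^ a)) ⟩
    2 ^ a + 2 ^ a       ≤⟨ +-mono-≤ lo lo ⟩
    p + p               ≤⟨ 2p≤n ⟩
    n                   ∎

lookup-injective : ∀ {X : Set} {xs : List X} → Unique xs → ∀ i j → lookup xs i ≡ lookup xs j → i ≡ j
lookup-injective (_ ∷ _) zero zero _ = refl
lookup-injective {xs = _ ∷ xs} (x∉ ∷ _) zero (suc j) eq = contradiction eq (All.lookup x∉ (∈-lookup j))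
lookup-injective {xs = _ ∷ xs} (x∉ ∷ _) (suc i) zero eq = contradiction (sym eq) (All.lookup x∉ (∈-lookup i))
lookup-injective (_ ∷ unique) (suc i) (suc j) eq = cong suc (lookup-injective unique i j eq)

toFin : Direction → Fin 2
toFin forward  = zero
toFin backward = suc zero

toFin-injective : ∀ k k′ → toFin k ≡ toFin k′ → k ≡ k′
toFin-injective forward  forward  _ = refl
toFin-injective backward backward _ = refl

-- Counting the charges.

module _ {S : Set} (A : ℕ → ℕ → S) (n : ℕ) (rs : List Rect) (unique : Unique rs)
         (charges : ∀ x → ∃[ p ] ∃[ q ] ∃[ k ] ∃[ c ] Charged A n (lookup rs x) p q k c) where
  private
    open Charged

    Run = Fin (length rs)
    L = ⌊log₂ n ⌋

    p q c bottom : Run → ℕ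
    p x = proj₁ (charges x)
    q x = proj₁ (proj₂ (charges x))
    c x = proj₁ (proj₂ (proj₂ (proj₂ (charges x))))
    bottom x = i2 (lookup rs x)

    k : Run → Direction
    k x = proj₁ (proj₂ (proj₂ (charges x)))

    charged : ∀ x → Charged A n (lookup rs x) (p x) (q x) (k x) (c x)
    charged x = proj₂ (proj₂ (proj₂ (proj₂ (charges x))))

    scaleₕ : ∀ x → ∃[ a ] (2 ^ a ≤ p x × p x < 2 ^ a + 2 ^ a)
    scaleₕ x = dyadic-scale (p x) (proj₁ (proj₁ (hper (charged x))))

    scaleᵥ : ∀ x → ∃[ a ] (2 ^ a ≤ q x × q x < 2 ^ a + 2 ^ a)
    scaleᵥ x = dyadic-scale (q x) (proj₁ (proj₁ (vper (charged x))))

    a b : Run → ℕ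
    a x = proj₁ (scaleₕ x)
    b x = proj₁ (scaleᵥ x)

    a<L : ∀ x → a x < L
    a<L x = scale<log (proj₁ (proj₂ (scaleₕ x)))
      (≤-trans (m≤n+m _ (start (charged x))) (≤-trans (≤right (charged x)) (right<n (charged x))))

    b<L : ∀ x → b x < L
    b<L x = scale<log (proj₁ (proj₂ (scaleᵥ x)))
      (≤-trans (m≤n+m _ (i1 (lookup rs x))) (≤-trans (tall (charged x)) (bottom<n (charged x))))

    c<n : ∀ x → c x < n
    c<n x = ≤-<-trans (c≤right (charged x)) (right<n (charged x))

    K : Run → Fin (2 * (n * n) * (L * L))
    K x = combine (combine (toFin (k x)) (combine (fromℕ< (bottom<n (charged x))) (fromℕ< (c<n x))))
                  (combine (fromℕ< (a<L x)) (fromℕ< (b<L x)))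

    K-sound : ∀ x y → K x ≡ K y →
      k x ≡ k y × bottom x ≡ bottom y × c x ≡ c y × a x ≡ a y × b x ≡ b y
    K-sound x y eq =
      let place , scales = Fin.combine-injective _ _ _ _ eq
          dir , cell     = Fin.combine-injective _ _ _ _ place
          row , col      = Fin.combine-injective _ _ _ _ cell
          sp , sq        = Fin.combine-injective _ _ _ _ scales
      in toFin-injective _ _ dir
       , Fin.fromℕ<-injective _ _ (bottom<n (charged x)) (bottom<n (charged y)) row
       , Fin.fromℕ<-injective _ _ (c<n x) (c<n y) col
       , Fin.fromℕ<-injective _ _ (a<L x) (a<L y) sp
       , Fin.fromℕ<-injective _ _ (b<L x) (b<L y) sq

    -- `Eₕ x` depends on `K x` alone, `Eᵥ x` also on `p x`; therefore `p` is separated before `q`.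
    Eₕ Eᵥ : Run → Rel ℕ 0ℓ
    Eₕ x = Strip A (bottom x) (2 ^ b x + 2 ^ b x) on walk (k x) (c x)
    Eᵥ x = Block A (start (charged x)) (p x + p x) on walk backward (bottom x)

    minₕ : ∀ x → MinSquare (Eₕ x) (p x)
    minₕ x = hper-minSquare A (charged x) (<⇒≤ (proj₂ (proj₂ (scaleᵥ x))))
      (+-mono-≤ (proj₁ (proj₂ (scaleᵥ x))) (proj₁ (proj₂ (scaleᵥ x))))

    minᵥ : ∀ x → MinSquare (Eᵥ x) (q x)
    minᵥ x = vper-minSquare A (charged x)

    Eₕ-cong : ∀ x y → K x ≡ K y → Eₕ x ≡ Eₕ y
    Eₕ-cong x y eq = let k≡ , row≡ , c≡ , _ , b≡ = K-sound x y eq in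
      cong₂ _on_ (cong₂ (Strip A) row≡ (cong (λ e → 2 ^ e + 2 ^ e) b≡)) (cong₂ walk k≡ c≡)

    start-cong : ∀ x y → K x ≡ K y → p x ≡ p y → start (charged x) ≡ start (charged y)
    start-cong x y eq p≡ = let k≡ , _ , c≡ , _ = K-sound x y eq in Window-unique (k y)
      (subst (λ k → Window k (c y) (p y) (start (charged x))) k≡
        (subst₂ (λ c p → Window (k x) c p (start (charged x))) c≡ p≡ (window (charged x))))
      (window (charged y))

    Eᵥ-cong : ∀ x y → K x ≡ K y → p x ≡ p y → Eᵥ x ≡ Eᵥ y
    Eᵥ-cong x y eq p≡ = let _ , row≡ , _ = K-sound x y eq in
      cong₂ _on_ (cong₂ (Block A) (start-cong x y eq p≡) (cong (λ p → p + p) p≡)) (cong (walk backward) row≡)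

    same-scale : ∀ {a a′ u w} → 2 ^ a ≤ u → w < 2 ^ a′ + 2 ^ a′ → a ≡ a′ → w < u + u
    same-scale lo hi refl = ≤-trans hi (+-mono-≤ lo lo)

    ¬threeₕ : ∀ x y z → K x ≡ K y → K x ≡ K z → p x < p y → p y < p z → ⊥
    ¬threeₕ x y z xy xz x<y y<z =
      no-three-squares (On.isEquivalence (walk (k x) (c x)) (Strip-isEquivalence A _ _)) (minₕ x)
        (subst (λ E → Per E (p y) (p y + p y)) (sym (Eₕ-cong x y xy)) (proj₁ (minₕ y)))
        (subst (λ E → Per E (p z) (p z + p z)) (sym (Eₕ-cong x z xz)) (proj₁ (minₕ z)))
        x<y y<z
        (same-scale (proj₁ (proj₂ (scaleₕ x))) (proj₂ (proj₂ (scaleₕ z)))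
          (proj₁ (proj₂ (proj₂ (proj₂ (K-sound x z xz))))))

    refineₕ = refine K p ¬threeₕ
    Kₕ = proj₁ refineₕ

    ¬threeᵥ : ∀ x y z → Kₕ x ≡ Kₕ y → Kₕ x ≡ Kₕ z → q x < q y → q y < q z → ⊥
    ¬threeᵥ x y z xy xz x<y y<z =
      let Kxy , pxy = proj₂ refineₕ x y xy
          Kxz , pxz = proj₂ refineₕ x z xz
      in
      no-three-squares (On.isEquivalence (walk backward (bottom x)) (Block-isEquivalence A _ _)) (minᵥ x)
        (subst (λ E → Per E (q y) (q y + q y)) (sym (Eᵥ-cong x y Kxy pxy)) (proj₁ (minᵥ y)))
        (subst (λ E → Per E (q z) (q z + q z)) (sym (Eᵥ-cong x z Kxz pxz)) (proj₁ (minᵥ z)))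
        x<y y<z
        (same-scale (proj₁ (proj₂ (scaleᵥ x))) (proj₂ (proj₂ (scaleᵥ z)))
          (proj₂ (proj₂ (proj₂ (proj₂ (K-sound x z Kxz))))))

    refineᵥ = refine Kₕ q ¬threeᵥ

    code-injective : ∀ {x y} → proj₁ refineᵥ x ≡ proj₁ refineᵥ y → x ≡ y
    code-injective {x} {y} eq =
      let eqₕ , q≡ = proj₂ refineᵥ x y eq
          eqK , p≡ = proj₂ refineₕ x y eqₕ
          k≡ , row≡ , c≡ , _ = K-sound x y eqK
      in lookup-injective unique x y (Charged-injective A (charged x) (charged y) row≡ p≡ q≡ k≡ c≡)

  charged-bound : length rs ≤ 8 * (n * n) * (L * L)
  -- Eight counts two directions, two values of `p` and two of `q`.
  charged-bound = ≤-trans (Fin.injective⇒≤ {f = proj₁ refineᵥ} code-injective) (≤-reflexive (assemble n L))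
    where
    assemble : ∀ x y → 2 * (x * x) * (y * y) * 2 * 2 ≡ 8 * (x * x) * (y * y)
    assemble x y = solve (x ∷ y ∷ [])

theorem9 : ∃[ C ] ∃[ n₀ ] (∀ n → n₀ ≤ n → {S : Set} (A : ℕ → ℕ → S) (rs : List Rect) → Unique rs → All (Is2DRun A n) rs → length rs ≤ C * (n * n) * (⌊log₂ n ⌋ * ⌊log₂ n ⌋))
-- The threshold is 0: for `n < 2` the logarithm vanishes, and there is no run, as a run has at
-- least two columns.
theorem9 = 8 , 0 , λ n _ A rs unique runs → decidable-stable (_ ≤? _)
  (¬¬-map (charged-bound A n rs unique)
    (¬¬-sequence λ x → charge A (All.lookup runs (∈-lookup x))))
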